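{- Let $(A,\gamma)$ be a quasiordered set and let $\{\alpha_i\mid i\in I\}$ be a half-space realizer of $\gamma$ with $|I|\ge2$. Then there exists a family $(R_i)_{i\in I}$, indexed by the same set $I$, of linear extensions of the induced partial order $r_\gamma$ on $A/(\gamma\cap\gamma^{ -1})$ such that $\bigcap_{i\in I}R_i=r_\gamma$.
   Context: A quasiorder on $A$ is a reflexive and transitive relation; $\Delta_A=\{(a,a)\mid a\in A\}$. A quasiorder $\alpha$ on $A$ is a half-space if there is a quasiorder $\beta$ on $A$ with $\alpha\cup\beta=A\times A$ and $\alpha\cap\beta=\Delta_A$. A half-space realizer of a quasiorder $\gamma$ on $A$ is a set $\{\alpha_i\mid i\in I\}$ of half-spaces on $A$ with $\bigcap_{i\in I}\alpha_i=\gamma$. For a quasiorder $\gamma$, $r_\gamma$ is the induced partial order on $A/(\gamma\cap\gamma^{ -1})$: $([a],[b])\in r_\gamma$ iff $(a,b)\in\gamma$. -}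

module Defs where

open import Level using (Level; _⊔_; suc)
open import Data.Product.Base using (_×_; ∃-syntax)
open import Relation.Binary.Core using (Rel; _⇒_; _⇔_)
open import Relation.Binary.Definitions using (Universal)
open import Relation.Binary.Structures using (IsPreorder; IsTotalOrder)
open import Relation.Binary.Bundles using (Poset)
open import Relation.Binary.PropositionalEquality.Core using (_≡_)
open import Relation.Binary.Construct.Union using (_∪_)
open import Relation.Binary.Construct.Intersection using (_∩_)
import Relation.Binary.Construct.Interior.Symmetric as SymInterior

private
  variable
    a i ℓ ℓ₁ ℓ₂ : Level

IsQuasiorder : {A : Set a} → Rel A ℓ → Set (a ⊔ ℓ)
IsQuasiorder γ = IsPreorder _≡_ γ

⋂ : {A : Set a} {I : Set i} → (I → Rel A ℓ) → Rel A (i ⊔ ℓ)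
⋂ α x y = ∀ k → α k x y

record IsHalfSpace {A : Set a} (α : Rel A ℓ) : Set (a ⊔ suc ℓ) where
  field
    isQuasiorder : IsQuasiorder α
    complement   : ∃[ β ] IsQuasiorder {ℓ = ℓ} β
                        × Universal (α ∪ β)
                        × (α ∩ β) ⇔ _≡_

record IsHalfSpaceRealizer {A : Set a} {I : Set i}
                           (γ : Rel A ℓ) (α : I → Rel A ℓ) : Set (a ⊔ i ⊔ suc ℓ) where
  field
    halfSpace    : ∀ k → IsHalfSpace (α k)
    intersection : ⋂ α ⇔ γ

-- The poset (A/(γ ∩ γ⁻¹), r_γ).  The quotient is the setoid on A whose
-- equality is γ ∩ γ⁻¹; writing a for its class [a], r_γ is γ itself.
inducedPoset : {A : Set a} {γ : Rel A ℓ} → IsQuasiorder γ → Poset a ℓ ℓ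
inducedPoset {γ = γ} γ-quasi =
  SymInterior.poset {R = γ} (IsPreorder.refl γ-quasi) (IsPreorder.trans γ-quasi)

-- IsTotalOrder over the poset's own equality makes R a well-defined relation
-- on the quotient: it contains _≈_ and is transitive, hence respects _≈_.
record IsLinearExtension (P : Poset a ℓ₁ ℓ₂) (R : Rel (Poset.Carrier P) ℓ₂) : Set (a ⊔ ℓ₁ ⊔ ℓ₂) where
  open Poset P
  field
    isTotalOrder : IsTotalOrder _≈_ R
    extends      : _≤_ ⇒ R

{-# OPTIONS --safe #-}

-- A half-space α is a linear sum of blocks, each of which is either full
-- (all pairs related) or empty (no two distinct elements related); the blocks
-- are linearly ordered by the weak order x ≤ y :⇔ (α y x → α x y).  Let δ be
-- the intersection of the weak orders of all α_k, let M be a linear extension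
-- of δ and L one of γ.  R_k compares x and y lexicographically: first by the
-- weak order of α_k, then by M inside full blocks and by the converse of M
-- inside empty ones, and finally by L for one chosen index and by the converse
-- of L for all others.  If R_k x y holds for every k, then δ x y, hence M x y;
-- if moreover x and y were distinct in an empty block of some α_k, then also
-- M y x, so that x and y are M-tied and L orders them in both directions.
module Submission where

open import Defs
open import Axiom.ExcludedMiddle using (ExcludedMiddle)
open import Axiom.Extensionality.Propositional using (Extensionality)
open import Data.Bool.Base using (Bool; T; true; false)
open import Data.Empty using (⊥-elim)
open import Data.Maybe.Base using (Maybe; just; nothing)
open import Data.Maybe.Properties using (just-injective)
open import Data.Product.Base using (_×_; Σ-syntax; ∃-syntax; _,_; proj₁; proj₂)
open import Data.Sum.Base using (_⊎_; inj₁; inj₂; [_,_]′)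
open import Function.Base using (_∘_; id)
open import Level using (Level; Lift; lift; _⊔_)
open import Relation.Binary.Bundles using (Poset)
open import Relation.Binary.Construct.Interior.Symmetric using (SymInterior; lhs≤rhs; rhs≤lhs) renaming (_,_ to _,ˢ_)
open import Relation.Binary.Core using (Rel; _⇔_; _⇒_)
open import Relation.Binary.Definitions using (Reflexive; Transitive; Total)
open import Relation.Binary.PropositionalEquality.Core using (_≡_; _≢_; refl; sym; trans; subst)
open import Relation.Binary.PropositionalEquality.Properties using () renaming (isEquivalence to ≡-isEquivalence)
open import Relation.Binary.Structures using (IsPreorder; IsTotalOrder)
open import Relation.Nullary.Decidable using (yes; no; isYes; True; toWitness; fromWitness; decidable-stable)
open import Relation.Nullary.Negation using (¬_; contradiction)
open import Relation.Unary using (Pred)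

-- Propositions moved between universe levels.

module Resizing (em : ∀ {ℓ} → ExcludedMiddle ℓ) where

  -- Excluded middle turns `P` into a Boolean, which lifts to any level; this returns orders built
  -- at larger levels to the level of the given relation.
  Resize : ∀ ℓ {p} → Set p → Set ℓ
  Resize ℓ P = Lift ℓ (True (em {P = P}))

  resize : ∀ {ℓ p} {P : Set p} → P → Resize ℓ P
  resize {P = P} p = lift (fromWitness {a? = em {P = P}} p)

  unresize : ∀ {ℓ p} {P : Set p} → Resize ℓ P → P
  unresize {P = P} (lift t) = toWitness {a? = em {P = P}} t

-- Zermelo's well-ordering argument.  Subsets are Bool-valued so that
-- extensionally equal ones are equal, which makes the choice of the next
-- element depend only on the extension.
module Towers (em : ∀ {ℓ} → ExcludedMiddle ℓ)
              (ext : ∀ {ℓ₁ ℓ₂} → Extensionality ℓ₁ ℓ₂)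
              {a : Level} (A : Set a) where

  Subset : Set a
  Subset = A → Bool

  infix 4 _∈_ _⊆_

  _∈_ : A → Subset → Set
  x ∈ S = T (S x)

  _⊆_ : Rel Subset a
  S ⊆ U = ∀ x → x ∈ S → x ∈ U

  ⟦_⟧ : ∀ {p} → Pred A p → Subset
  ⟦ P ⟧ x = isYes (em {P = P x})

  ∈⟦⟧⁺ : ∀ {p} (P : Pred A p) {x} → P x → x ∈ ⟦ P ⟧
  ∈⟦⟧⁺ P {x} = fromWitness {a? = em {P = P x}}

  ∈⟦⟧⁻ : ∀ {p} (P : Pred A p) {x} → x ∈ ⟦ P ⟧ → P x
  ∈⟦⟧⁻ P {x} = toWitness {a? = em {P = P x}}

  T-injective : ∀ {b c} → (T b → T c) → (T c → T b) → b ≡ c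
  T-injective {false} {false} _ _ = refl
  T-injective {false} {true}  _ g = ⊥-elim (g _)
  T-injective {true}  {false} f _ = ⊥-elim (f _)
  T-injective {true}  {true}  _ _ = refl

  ⊆-antisym : ∀ {S U} → S ⊆ U → U ⊆ S → S ≡ U
  ⊆-antisym S⊆U U⊆S = ext λ x → T-injective (S⊆U x) (U⊆S x)

  -- As `em` decides a sigma type it also hands over a witness, and so serves as the choice
  -- function.
  next : Subset → Maybe A
  next S with em {P = ∃[ x ] ¬ x ∈ S}
  ... | yes (x , _) = just x
  ... | no _        = nothing

  next-∉ : ∀ S {x} → next S ≡ just x → ¬ x ∈ S
  next-∉ S eq with em {P = ∃[ x ] ¬ x ∈ S}
  next-∉ S refl | yes (_ , x∉S) = x∉S

  next-full : ∀ S → next S ≡ nothing → ∀ x → x ∈ S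
  next-full S eq x with em {P = ∃[ x ] ¬ x ∈ S}
  ... | no ¬∃ = decidable-stable em λ x∉S → ¬∃ (x , x∉S)

  grow : Subset → Subset
  grow S = ⟦ (λ x → x ∈ S ⊎ next S ≡ just x) ⟧

  grow⁻ : ∀ S {x} → x ∈ grow S → x ∈ S ⊎ next S ≡ just x
  grow⁻ S = ∈⟦⟧⁻ (λ x → x ∈ S ⊎ next S ≡ just x)

  grow⁺ : ∀ S {x} → x ∈ S ⊎ next S ≡ just x → x ∈ grow S
  grow⁺ S = ∈⟦⟧⁺ (λ x → x ∈ S ⊎ next S ≡ just x)

  ⊆-grow : ∀ S → S ⊆ grow S
  ⊆-grow S _ = grow⁺ S ∘ inj₁

  ⋃ᵗ : (Subset → Bool) → Subset
  ⋃ᵗ Q = ⟦ (λ x → ∃[ S ] T (Q S) × x ∈ S) ⟧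

  ⋃ᵗ⁺ : ∀ Q {S} → T (Q S) → S ⊆ ⋃ᵗ Q
  ⋃ᵗ⁺ Q {S} q x x∈S = ∈⟦⟧⁺ (λ x → ∃[ S ] T (Q S) × x ∈ S) (S , q , x∈S)

  ⋃ᵗ⁻ : ∀ Q {x} → x ∈ ⋃ᵗ Q → ∃[ S ] T (Q S) × x ∈ S
  ⋃ᵗ⁻ Q = ∈⟦⟧⁻ (λ x → ∃[ S ] T (Q S) × x ∈ S)

  -- The empty set needs no constructor: it is the union of the empty family.
  data Tower : Subset → Set a where
    step  : ∀ {S} → Tower S → Tower (grow S)
    union : ∀ Q → (∀ S → T (Q S) → Tower S) → Tower (⋃ᵗ Q)

  sandwich : ∀ {S U} → S ⊆ U → U ⊆ grow S → U ≡ S ⊎ grow S ⊆ U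
  sandwich {S} {U} S⊆U U⊆S⁺ with em {P = ∃[ x ] x ∈ U × next S ≡ just x}
  ... | yes (x , x∈U , eq) = inj₂ λ y y∈S⁺ →
    [ S⊆U y , (λ eq′ → subst (_∈ U) (just-injective (trans (sym eq) eq′)) x∈U) ]′ (grow⁻ S y∈S⁺)
  ... | no ¬∃ = inj₁ (⊆-antisym
    (λ y y∈U → [ id , (λ eq → contradiction (y , y∈U , eq) ¬∃) ]′ (grow⁻ S (U⊆S⁺ y y∈U)))
    S⊆U)

  -- Double induction, on the first tower and, when that is `grow S`, on the second. A union either
  -- has a member containing the successor of the other tower, or all its members lie inside that
  -- tower.
  tower-linear : ∀ {S U} → Tower S → Tower U → S ⊆ U ⊎ grow U ⊆ S
  tower-linear {U = U} (union Q t) u with em {P = ∃[ S ] T (Q S) × grow U ⊆ S}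
  ... | yes (S , q , U⁺⊆S) = inj₂ λ x → ⋃ᵗ⁺ Q q x ∘ U⁺⊆S x
  ... | no ¬∃ = inj₁ λ x x∈⋃ → let (S , q , x∈S) = ⋃ᵗ⁻ Q x∈⋃ in
    [ (λ S⊆U → S⊆U x x∈S) , (λ U⁺⊆S → contradiction (S , q , U⁺⊆S) ¬∃) ]′ (tower-linear (t S q) u)
  tower-linear (step {S} s) u = compare u
    where
    -- The outer hypothesis compares `S` with `U`; what remains is `S ⊆ U ⊆ grow S`, with at most
    -- one element in doubt.
    refine : ∀ {U} → Tower U → grow S ⊆ U ⊎ U ⊆ grow S → grow S ⊆ U ⊎ grow U ⊆ grow S
    refine u (inj₁ S⁺⊆U) = inj₁ S⁺⊆U
    refine u (inj₂ U⊆S⁺) with tower-linear s u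
    ... | inj₂ U⁺⊆S = inj₂ λ x → ⊆-grow S x ∘ U⁺⊆S x
    ... | inj₁ S⊆U with sandwich S⊆U U⊆S⁺
    ...   | inj₁ refl  = inj₂ λ _ → id
    ...   | inj₂ S⁺⊆U = inj₁ S⁺⊆U

    compare : ∀ {U} → Tower U → grow S ⊆ U ⊎ grow U ⊆ grow S
    compare (step {U} u) = refine (step u)
      ([ (λ S⁺⊆U → inj₁ λ x → ⊆-grow U x ∘ S⁺⊆U x) , inj₂ ]′ (compare u))
    compare (union Q t) with em {P = ∃[ V ] T (Q V) × grow S ⊆ V}
    ... | yes (V , q , S⁺⊆V) = inj₁ λ x → ⋃ᵗ⁺ Q q x ∘ S⁺⊆V x
    ... | no ¬∃ = refine (union Q t) (inj₂ λ x x∈⋃ → let (V , q , x∈V) = ⋃ᵗ⁻ Q x∈⋃ in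
      [ (λ S⁺⊆V → contradiction (V , q , S⁺⊆V) ¬∃) , (λ V⁺⊆S⁺ → V⁺⊆S⁺ x (⊆-grow V x x∈V)) ]′
        (compare (t V q)))

  tower-trichotomy : ∀ {S U} → Tower S → Tower U → grow S ⊆ U ⊎ S ≡ U ⊎ grow U ⊆ S
  tower-trichotomy s u with tower-linear s u | tower-linear u s
  ... | inj₂ U⁺⊆S | _          = inj₂ (inj₂ U⁺⊆S)
  ... | inj₁ _    | inj₂ S⁺⊆U  = inj₁ S⁺⊆U
  ... | inj₁ S⊆U  | inj₁ U⊆S   = inj₂ (inj₁ (⊆-antisym S⊆U U⊆S))

-- Szpilrajn's extension theorem.

-- The elements are ordered by their principal down-sets, compared
-- lexicographically along the well-ordering given by the towers.
module Szpilrajn (em : ∀ {ℓ} → ExcludedMiddle ℓ)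
                 (ext : ∀ {ℓ₁ ℓ₂} → Extensionality ℓ₁ ℓ₂)
                 {a ℓ₁ ℓ₂ : Level} (P : Poset a ℓ₁ ℓ₂) where

  open Poset P renaming (Carrier to A; trans to ≤-trans; refl to ≤-refl; antisym to ≤-antisym)
  open Resizing em
  open Towers em ext A

  Agree : Subset → A → A → Set (a ⊔ ℓ₂)
  Agree S x y = ∀ z → z ∈ S → (z ≤ x → z ≤ y) × (z ≤ y → z ≤ x)

  infix 4 _≺_ _≼_

  -- `z` is the first element at which the down-sets differ; the side containing it counts as
  -- larger, so that `≤` is extended.
  _≺_ : Rel A (a ⊔ ℓ₂)
  x ≺ y = ∃[ S ] Tower S × Agree S x y × (∃[ z ] next S ≡ just z × z ≤ y × ¬ z ≤ x)

  Agree-trans : ∀ {S x y z} → Agree S x y → Agree S y z → Agree S x z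
  Agree-trans p q w w∈S =
    proj₁ (q w w∈S) ∘ proj₁ (p w w∈S) , proj₂ (p w w∈S) ∘ proj₂ (q w w∈S)

  Agree-grow : ∀ {S U x y} → grow S ⊆ U → Agree U x y → Agree S x y
  Agree-grow {S} S⁺⊆U p w = p w ∘ S⁺⊆U w ∘ ⊆-grow S w

  ≺-irrefl : ∀ {x} → ¬ x ≺ x
  ≺-irrefl (_ , _ , _ , _ , _ , z≤x , z≰x) = z≰x z≤x

  -- The earlier of the two first differences decides; they cannot coincide, since that element
  -- would be both below `y` and not below `y`.
  ≺-trans : Transitive _≺_
  ≺-trans (S , s , p , v , eq , v≤y , v≰x) (U , u , q , w , eq′ , w≤z , w≰y)
    with tower-trichotomy s u
  ... | inj₁ S⁺⊆U = S , s , Agree-trans p (Agree-grow S⁺⊆U q) , v , eq ,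
    proj₁ (q v (S⁺⊆U v (grow⁺ S (inj₂ eq)))) v≤y , v≰x
  ... | inj₂ (inj₂ U⁺⊆S) = U , u , Agree-trans (Agree-grow U⁺⊆S p) q , w , eq′ ,
    w≤z , w≰y ∘ proj₁ (p w (U⁺⊆S w (grow⁺ U (inj₂ eq′))))
  ... | inj₂ (inj₁ refl) =
    contradiction (subst (_≤ _) (just-injective (trans (sym eq) eq′)) v≤y) w≰y

  ≺-respˡ : ∀ {x y z} → x ≈ y → y ≺ z → x ≺ z
  ≺-respˡ x≈y (S , s , p , w , eq , w≤z , w≰y) =
    S , s
    , (λ v v∈S → proj₁ (p v v∈S) ∘ (λ v≤x → ≤-trans v≤x (reflexive x≈y))
               , (λ v≤y → ≤-trans v≤y (reflexive (Eq.sym x≈y))) ∘ proj₂ (p v v∈S))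
    , w , eq , w≤z , λ w≤x → w≰y (≤-trans w≤x (reflexive x≈y))

  ≺-respʳ : ∀ {x y z} → y ≈ z → x ≺ y → x ≺ z
  ≺-respʳ y≈z (S , s , p , w , eq , w≤y , w≰x) =
    S , s
    , (λ v v∈S → (λ v≤y → ≤-trans v≤y (reflexive y≈z)) ∘ proj₁ (p v v∈S)
               , proj₂ (p v v∈S) ∘ (λ v≤z → ≤-trans v≤z (reflexive (Eq.sym y≈z))))
    , w , eq , ≤-trans w≤y (reflexive y≈z) , w≰x

  -- The union of all towers on which the two down-sets agree is the largest
  -- such tower, so they differ at its next element.
  ≺-compare : ∀ x y → x ≈ y ⊎ x ≺ y ⊎ y ≺ x
  ≺-compare x y = go (next S) refl
    where
    Q : Subset → Bool
    Q V = isYes (em {P = Tower V × Agree V x y})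

    Q⁻ : ∀ V → T (Q V) → Tower V × Agree V x y
    Q⁻ V = toWitness {a? = em {P = Tower V × Agree V x y}}

    S : Subset
    S = ⋃ᵗ Q

    s : Tower S
    s = union Q λ V q → proj₁ (Q⁻ V q)

    agree : Agree S x y
    agree z z∈S = let (V , q , z∈V) = ⋃ᵗ⁻ Q z∈S in proj₂ (Q⁻ V q) z z∈V

    differ : ∀ {z} → next S ≡ just z → ¬ ((z ≤ x → z ≤ y) × (z ≤ y → z ≤ x))
    -- Otherwise `grow S` would be one of the towers united in `S`, putting `z` into `S`.
    differ {z} eq e = next-∉ S eq
      (⋃ᵗ⁺ Q (fromWitness {a? = em {P = Tower (grow S) × Agree (grow S) x y}} (step s , agree⁺))
        z (grow⁺ S (inj₂ eq)))
      where
      agree⁺ : Agree (grow S) x y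
      agree⁺ v v∈S⁺ with grow⁻ S v∈S⁺
      ... | inj₁ v∈S = agree v v∈S
      ... | inj₂ eq′ with just-injective (trans (sym eq) eq′)
      ...   | refl = e

    go : ∀ m → next S ≡ m → x ≈ y ⊎ x ≺ y ⊎ y ≺ x
    go nothing eq = inj₁ (≤-antisym
      (proj₁ (agree x (next-full S eq x)) ≤-refl)
      (proj₂ (agree y (next-full S eq y)) ≤-refl))
    go (just z) eq with em {P = z ≤ x} | em {P = z ≤ y}
    ... | yes z≤x | yes z≤y = contradiction ((λ _ → z≤y) , (λ _ → z≤x)) (differ eq)
    ... | no z≰x  | no z≰y  = contradiction ((⊥-elim ∘ z≰x) , (⊥-elim ∘ z≰y)) (differ eq)
    ... | no z≰x  | yes z≤y = inj₂ (inj₁ (S , s , agree , z , eq , z≤y , z≰x))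
    ... | yes z≤x | no z≰y  = inj₂ (inj₂
      (S , s , (λ v v∈S → proj₂ (agree v v∈S) , proj₁ (agree v v∈S)) , z , eq , z≤x , z≰y))

  _≼_ : Rel A ℓ₂
  x ≼ y = Resize ℓ₂ (x ≈ y ⊎ x ≺ y)

  ≼-trans : Transitive _≼_
  ≼-trans p q with unresize p | unresize q
  ... | inj₁ x≈y | inj₁ y≈z = resize (inj₁ (Eq.trans x≈y y≈z))
  ... | inj₁ x≈y | inj₂ y≺z = resize (inj₂ (≺-respˡ x≈y y≺z))
  ... | inj₂ x≺y | inj₁ y≈z = resize (inj₂ (≺-respʳ y≈z x≺y))
  ... | inj₂ x≺y | inj₂ y≺z = resize (inj₂ (≺-trans x≺y y≺z))

  ≼-antisym : ∀ {x y} → x ≼ y → y ≼ x → x ≈ y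
  ≼-antisym p q with unresize p | unresize q
  ... | inj₁ x≈y | _        = x≈y
  ... | inj₂ _   | inj₁ y≈x = Eq.sym y≈x
  ... | inj₂ x≺y | inj₂ y≺x = contradiction (≺-trans x≺y y≺x) ≺-irrefl

  ≼-total : Total _≼_
  ≼-total x y with ≺-compare x y
  ... | inj₁ x≈y        = inj₁ (resize (inj₁ x≈y))
  ... | inj₂ (inj₁ x≺y) = inj₁ (resize (inj₂ x≺y))
  ... | inj₂ (inj₂ y≺x) = inj₂ (resize (inj₂ y≺x))

  ≤⇒≼ : _≤_ ⇒ _≼_
  ≤⇒≼ {x} {y} x≤y with ≺-compare x y
  ... | inj₁ x≈y        = resize (inj₁ x≈y)
  ... | inj₂ (inj₁ x≺y) = resize (inj₂ x≺y)
  ... | inj₂ (inj₂ (_ , _ , _ , _ , _ , z≤x , z≰y)) = contradiction (≤-trans z≤x x≤y) z≰y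

  ≼-isLinearExtension : IsLinearExtension P _≼_
  ≼-isLinearExtension = record
    { isTotalOrder = record
      { isPartialOrder = record
        { isPreorder = record
          { isEquivalence = isEquivalence
          ; reflexive     = λ x≈y → resize (inj₁ x≈y)
          ; trans         = ≼-trans
          }
        ; antisym = ≼-antisym
        }
      ; total = ≼-total
      }
    ; extends = ≤⇒≼
    }

abstract
  szpilrajn : (∀ {ℓ} → ExcludedMiddle ℓ) → (∀ {ℓ₁ ℓ₂} → Extensionality ℓ₁ ℓ₂) →
    ∀ {a ℓ₁ ℓ₂} (P : Poset a ℓ₁ ℓ₂) → Σ[ R ∈ Rel (Poset.Carrier P) ℓ₂ ] IsLinearExtension P R
  szpilrajn em ext P = _≼_ , ≼-isLinearExtension
    where open Szpilrajn em ext P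

-- Lexicographic products.

Tied : ∀ {a p} {A : Set a} → Rel A p → Rel A p
Tied P x y = P x y × P y x

Lex : ∀ {a p q} {A : Set a} → Rel A p → Rel A q → Rel A (p ⊔ q)
Lex P Q x y = P x y × (P y x → Q x y)

module _ {a p q : Level} {A : Set a} {P : Rel A p} {Q : Rel A q} where

  -- `Q` has to be transitive only along ties of `P`, which is all that `Twist-trans` offers.
  Lex-trans : Transitive P →
    (∀ {x y z} → Tied P x y → Tied P y z → Q x y → Q y z → Q x z) →
    Transitive (Lex P Q)
  Lex-trans P-trans Q-trans (xy , f) (yz , g) = P-trans xy yz , λ zx →
    let yx = P-trans yz zx
        zy = P-trans zx xy
    in Q-trans (xy , yx) (yz , zy) (f yx) (g zy)

  Lex-total : ExcludedMiddle p → Total P → (∀ {x y} → Tied P x y → Q x y ⊎ Q y x) →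
    Total (Lex P Q)
  Lex-total em P-total Q-total x y with em {P = P x y} | em {P = P y x}
  ... | no ¬xy | no ¬yx = contradiction (P-total x y) [ ¬xy , ¬yx ]′
  ... | yes xy | no ¬yx = inj₁ (xy , λ yx → contradiction yx ¬yx)
  ... | no ¬xy | yes yx = inj₂ (yx , λ xy → contradiction xy ¬xy)
  ... | yes xy | yes yx with Q-total (xy , yx)
  ...   | inj₁ r = inj₁ (xy , λ _ → r)
  ...   | inj₂ r = inj₂ (yx , λ _ → r)

-- The weak order of a half-space and the order inside its blocks.

Weak : ∀ {a ℓ} {A : Set a} → Rel A ℓ → Rel A ℓ
Weak α x y = α y x → α x y

-- M between α-related pairs and its converse between all others: inside a
-- block of α this is M if the block is full and its converse if it is empty.
Twist : ∀ {a ℓ m} {A : Set a} → Rel A ℓ → Rel A m → Rel A (ℓ ⊔ m)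
Twist α M x y = (α x y → M x y) × (¬ α x y → M y x)

module HalfSpace (em : ∀ {ℓ} → ExcludedMiddle ℓ) {a ℓ : Level} {A : Set a}
                 {α : Rel A ℓ} (α-half : IsHalfSpace α) where

  open IsHalfSpace α-half
  open IsPreorder isQuasiorder using () renaming (refl to α-refl; trans to α-trans)

  β : Rel A ℓ
  β = proj₁ complement

  β-trans : Transitive β
  β-trans = IsPreorder.trans (proj₁ (proj₂ complement))

  ¬α⇒β : ∀ {x y} → ¬ α x y → β x y
  ¬α⇒β {x} {y} ¬xy = [ (λ xy → contradiction xy ¬xy) , id ]′ (proj₁ (proj₂ (proj₂ complement)) x y)

  α∩β⇒≡ : ∀ {x y} → α x y → β x y → x ≡ y
  α∩β⇒≡ xy xy′ = proj₁ (proj₂ (proj₂ (proj₂ complement))) (xy , xy′)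

  -- The complement enters when neither `α z y` nor `α y x` holds: then `β z x`, which together with
  -- `α z x` forces equality.
  Weak-trans : Transitive (Weak α)
  Weak-trans {x} {y} {z} f g zx with em {P = α y x}
  ... | yes yx = α-trans (f yx) (g (α-trans zx (f yx)))
  ... | no ¬yx with em {P = α z y}
  ...   | yes zy = contradiction (α-trans (g zy) zx) ¬yx
  ...   | no ¬zy with α∩β⇒≡ zx (β-trans (¬α⇒β ¬zy) (¬α⇒β ¬yx))
  ...     | refl = α-refl

  Weak-total : Total (Weak α)
  Weak-total x y with em {P = α x y}
  ... | yes xy = inj₁ λ _ → xy
  ... | no ¬xy = inj₂ λ xy → contradiction xy ¬xy

  module _ {m : Level} {M : Rel A m}
           (M-refl : Reflexive M) (M-trans : Transitive M) (M-total : Total M) where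

    -- Tied elements share a block, full or empty. If one pair is α-related and the other is not,
    -- two steps of `β` show that the related pair is equal.
    Twist-trans : ∀ {x y z} → Tied (Weak α) x y → Tied (Weak α) y z →
      Twist α M x y → Twist α M y z → Twist α M x z
    Twist-trans {x} {y} {z} (yx⇒xy , xy⇒yx) (zy⇒yz , yz⇒zy) s t
      with em {P = α x y} | em {P = α y z}
    ... | yes xy | yes yz =
      (λ _ → M-trans (proj₁ s xy) (proj₁ t yz)) , λ ¬xz → contradiction (α-trans xy yz) ¬xz
    ... | no ¬xy | no ¬yz =
      (λ xz → subst (M x) (α∩β⇒≡ xz (β-trans (¬α⇒β ¬xy) (¬α⇒β ¬yz))) M-refl)
      , λ _ → M-trans (proj₂ t ¬yz) (proj₂ s ¬xy)
    ... | yes xy | no ¬yz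
      with refl ← α∩β⇒≡ xy (β-trans (¬α⇒β λ xz → ¬yz (α-trans (xy⇒yx xy) xz)) (¬α⇒β (¬yz ∘ zy⇒yz)))
      = t
    ... | no ¬xy | yes yz
      with refl ← α∩β⇒≡ yz (β-trans (¬α⇒β (¬xy ∘ yx⇒xy)) (¬α⇒β λ xz → ¬xy (α-trans xz (yz⇒zy yz))))
      = s

    Twist-total : ∀ {x y} → Tied (Weak α) x y → Twist α M x y ⊎ Twist α M y x
    Twist-total {x} {y} (yx⇒xy , xy⇒yx) with em {P = α x y} | M-total x y
    ... | yes xy | inj₁ m = inj₁ ((λ _ → m) , contradiction xy)
    ... | yes xy | inj₂ m = inj₂ ((λ _ → m) , contradiction (xy⇒yx xy))
    ... | no ¬xy | inj₁ m = inj₂ ((λ yx → contradiction (yx⇒xy yx) ¬xy) , λ _ → m)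
    ... | no ¬xy | inj₂ m = inj₁ ((λ xy → contradiction xy ¬xy) , λ _ → m)

-- The family of linear extensions built from a realizer.

module Realizer (em : ∀ {ℓ} → ExcludedMiddle ℓ)
                (ext : ∀ {ℓ₁ ℓ₂} → Extensionality ℓ₁ ℓ₂)
                {a i ℓ : Level} {A : Set a} (γ : Rel A ℓ) (γ-quasi : IsQuasiorder γ)
                {I : Set i} (α : I → Rel A ℓ) (realizer : IsHalfSpaceRealizer γ α)
                (j : I) where

  open IsHalfSpaceRealizer realizer
  open Resizing em
  module H (k : I) = HalfSpace em (halfSpace k)

  γ⇒α : ∀ {x y} → γ x y → ∀ k → α k x y
  γ⇒α = proj₂ intersection

  α⇒γ : ∀ {x y} → (∀ k → α k x y) → γ x y
  α⇒γ = proj₁ intersection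

  δ : Rel A (i ⊔ ℓ)
  δ = ⋂ (λ k → Weak (α k))

  δ-quasi : IsQuasiorder δ
  δ-quasi = record
    { isEquivalence = ≡-isEquivalence
    ; reflexive     = λ { refl _ → id }
    ; trans         = λ p q k → H.Weak-trans k (p k) (q k)
    }

  M-ext : Σ[ M ∈ Rel A (i ⊔ ℓ) ] IsLinearExtension (inducedPoset δ-quasi) M
  M-ext = szpilrajn em ext (inducedPoset δ-quasi)

  L-ext : Σ[ L ∈ Rel A ℓ ] IsLinearExtension (inducedPoset γ-quasi) L
  L-ext = szpilrajn em ext (inducedPoset γ-quasi)

  M : Rel A (i ⊔ ℓ)
  M = proj₁ M-ext

  L : Rel A ℓ
  L = proj₁ L-ext

  module M = IsLinearExtension (proj₂ M-ext)
  module MO = IsTotalOrder M.isTotalOrder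
  module LO = IsTotalOrder (IsLinearExtension.isTotalOrder (proj₂ L-ext))

  -- Any second index sees `L` reversed; this is where at least two indices are needed.
  Lᵏ : I → Rel A (i ⊔ ℓ)
  Lᵏ k x y = (k ≡ j → L x y) × (k ≢ j → L y x)

  Lᵏ-trans : ∀ k → Transitive (Lᵏ k)
  Lᵏ-trans k (p , p′) (q , q′) =
    (λ e → LO.trans (p e) (q e)) , (λ e → LO.trans (q′ e) (p′ e))

  Lᵏ-total : ∀ k → Total (Lᵏ k)
  Lᵏ-total k x y with em {P = k ≡ j} | LO.total x y
  ... | yes e | inj₁ l = inj₁ ((λ _ → l) , contradiction e)
  ... | yes e | inj₂ l = inj₂ ((λ _ → l) , contradiction e)
  ... | no ¬e | inj₁ l = inj₂ ((λ e → contradiction e ¬e) , λ _ → l)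
  ... | no ¬e | inj₂ l = inj₁ ((λ e → contradiction e ¬e) , λ _ → l)

  Lᵏ-antisym : ∀ k {x y} → Lᵏ k x y → Lᵏ k y x → SymInterior γ x y
  Lᵏ-antisym k (p , p′) (q , q′) with em {P = k ≡ j}
  ... | yes e = LO.antisym (p e) (q e)
  ... | no ¬e = LO.antisym (q′ ¬e) (p′ ¬e)

  Twist-tied : ∀ k {x y} → Tied (Weak (α k)) x y → Tied (Twist (α k) M) x y → SymInterior δ x y
  Twist-tied k {x} {y} (yx⇒xy , xy⇒yx) ((p , p′) , (q , q′)) with em {P = α k x y}
  ... | yes xy = MO.antisym (p xy) (q (xy⇒yx xy))
  ... | no ¬xy = MO.antisym (q′ (¬xy ∘ yx⇒xy)) (p′ ¬xy)

  B : I → Rel A (i ⊔ ℓ)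
  B k = Lex (Weak (α k)) (Twist (α k) M)

  B-trans : ∀ k → Transitive (B k)
  B-trans k = Lex-trans {P = Weak (α k)} {Q = Twist (α k) M}
    (H.Weak-trans k) (H.Twist-trans k MO.refl MO.trans MO.total)

  B-total : ∀ k → Total (B k)
  B-total k = Lex-total {P = Weak (α k)} {Q = Twist (α k) M} em
    (H.Weak-total k) (H.Twist-total k MO.refl MO.trans MO.total)

  B-antisym : ∀ k {x y} → B k x y → B k y x → SymInterior δ x y
  B-antisym k (w , t) (w′ , t′) = Twist-tied k (w , w′) (t w′ , t′ w)

  -- A γ-related pair is related by every `α k`, so it never meets the reversing clause of `Twist`.
  γ⇒B : ∀ k → γ ⇒ B k
  γ⇒B k xy = (λ _ → γ⇒α xy k)
    , λ _ → (λ _ → M.extends (λ m _ → γ⇒α xy m)) , contradiction (γ⇒α xy k)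

  R : I → Rel A ℓ
  R k x y = Resize ℓ (Lex (B k) (Lᵏ k) x y)

  γ∧δ⁻¹⇒γ⁻¹ : ∀ {x y} → γ x y → δ y x → γ y x
  γ∧δ⁻¹⇒γ⁻¹ xy d = α⇒γ λ k → d k (γ⇒α xy k)

  -- Reversing `L` is harmless: a γ-related pair tied in `B k` is already γ-equivalent.
  γ⇒R : ∀ k → γ ⇒ R k
  γ⇒R k xy = resize (γ⇒B k xy , λ b →
    let yx = γ∧δ⁻¹⇒γ⁻¹ xy (lhs≤rhs (B-antisym k b (γ⇒B k xy)))
    in (λ _ → LO.reflexive (xy ,ˢ yx)) , λ _ → LO.reflexive (yx ,ˢ xy))

  R-trans : ∀ k → Transitive (R k)
  R-trans k p q = resize
    (Lex-trans {P = B k} {Q = Lᵏ k} (B-trans k) (λ _ _ → Lᵏ-trans k) (unresize p) (unresize q))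

  R-antisym : ∀ k {x y} → R k x y → R k y x → SymInterior γ x y
  R-antisym k p q =
    let (b , l) = unresize p
        (b′ , l′) = unresize q
    in Lᵏ-antisym k (l b′) (l′ b)

  R-total : ∀ k → Total (R k)
  R-total k x y =
    [ inj₁ ∘ resize , inj₂ ∘ resize ]′
      (Lex-total {P = B k} {Q = Lᵏ k} em (B-total k) (λ {x} {y} _ → Lᵏ-total k x y) x y)

  R-isLinearExtension : ∀ k → IsLinearExtension (inducedPoset γ-quasi) (R k)
  R-isLinearExtension k = record
    { isTotalOrder = record
      { isPartialOrder = record
        { isPreorder = record
          { isEquivalence = Poset.isEquivalence (inducedPoset γ-quasi)
          ; reflexive     = γ⇒R k ∘ lhs≤rhs
          ; trans         = R-trans k
          }
        ; antisym = R-antisym k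
        }
      ; total = R-total k
      }
    ; extends = γ⇒R k
    }

  ⋂R⇒γ : ∀ {k} → k ≢ j → ⋂ R ⇒ γ
  -- A failure of `α m x y` would yield `γ x y`, and with it `α m x y`.
  ⋂R⇒γ {k} k≢j {x} {y} r = α⇒γ λ m → decidable-stable em λ ¬xy → ¬xy (γ⇒α (empty⇒γ m ¬xy) m)
    where
    δxy : δ x y
    δxy m = proj₁ (proj₁ (unresize (r m)))

    empty⇒γ : ∀ m → ¬ α m x y → γ x y
    empty⇒γ m ¬xy = lhs≤rhs (LO.antisym (proj₁ (Lᵏxy j) refl) (proj₂ (Lᵏxy k) k≢j))
      where
      Myx : M y x
      -- Without `α m x y`, `Weak (α m) y x` holds vacuously, so `Twist` applies with its reversing
      -- clause.
      Myx = proj₂ (proj₂ (proj₁ (unresize (r m))) (λ xy → contradiction xy ¬xy)) ¬xy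

      δyx : δ y x
      δyx = rhs≤lhs (MO.antisym (M.extends δxy) Myx)

      Lᵏxy : ∀ n → Lᵏ n x y
      Lᵏxy n = proj₂ (unresize (r n))
        -- With `M` holding both ways, either clause of `Twist` is met, so `B n y x` holds and `L`
        -- decides at every index.
        (δyx n , λ _ → (λ _ → M.extends δyx) , λ _ → M.extends δxy)

theorem2p13 : (∀ {ℓ} → ExcludedMiddle ℓ) → (∀ {ℓ₁ ℓ₂} → Extensionality ℓ₁ ℓ₂) →
    ∀ {a i ℓ} {A : Set a} (γ : Rel A ℓ) (γ-quasi : IsQuasiorder γ) →
    {I : Set i} (α : I → Rel A ℓ) → IsHalfSpaceRealizer γ α →
    (Σ[ j ∈ I ] Σ[ k ∈ I ] j ≢ k) →
    Σ[ R ∈ (I → Rel A ℓ) ]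
    (∀ k → IsLinearExtension (inducedPoset γ-quasi) (R k))
    × (⋂ R ⇔ Poset._≤_ (inducedPoset γ-quasi))
theorem2p13 em ext γ γ-quasi α realizer (j , k , j≢k) =
  R , R-isLinearExtension , ⋂R⇒γ (j≢k ∘ sym) , λ xy k → γ⇒R k xy
  where open Realizer em ext γ γ-quasi α realizer j
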